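{- Let $x\in[0,1)$ be rational, written in binary as $x=0.\alpha_1\alpha_2\alpha_3\ldots$ (choosing the expansion that does not end in infinitely many $1$'s). Define the walk $P_0=(0,0)$, $P_i=P_{i-1}+(1,0)$ if $\alpha_i=1$ and $P_i=P_{i-1}+(0,1)$ if $\alpha_i=0$. Let $X_i=1$ if $\gcd$ of the coordinates of $P_i$ equals $1$ and $X_i=0$ otherwise, and $\overline S_n(x)=\frac{X_1+\cdots+X_n}{n}$. Then $\lim_{n\to\infty}\overline S_n(x)$ exists and is a rational number. -}

module Defs where

open import Data.Bool.Base using (if_then_else_)
open import Data.Digit using (Bit; 1b)
open import Data.Fin.Base using (zero; suc; toℕ)
open import Data.Integer.Base using (+_)
open import Data.Nat.Base as ℕ using (ℕ; zero; suc; NonZero)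
open import Data.Nat.GCD using (gcd)
import Data.Nat.Properties as ℕ
open import Data.Product.Base using (_×_; _,_; ∃-syntax; uncurry)
open import Data.Rational.Base using (ℚ; 0ℚ; _/_; _+_; _-_; ∣_∣; _<_)
open import Relation.Binary.PropositionalEquality.Core using (_≡_)
open import Relation.Nullary.Decidable.Core using (does)
open import Relation.Nullary.Negation.Core using (¬_)

-- For a rational sequence and a rational limit, quantifying over rational ε
-- agrees with convergence in the reals.
ConvergesTo : (ℕ → ℚ) → ℚ → Set
ConvergesTo s l =
  ∀ (ε : ℚ) → 0ℚ < ε → ∃[ N ] (∀ n → N ℕ.≤ n → ∣ s n - l ∣ < ε)

-- A digit sequence α : ℕ → Bit stands for 0.α₁α₂α₃…, with α i holding the
-- digit α_{i+1}, of weight 2^-(i+1).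

binaryPartialSum : (ℕ → Bit) → ℕ → ℚ
binaryPartialSum α zero    = 0ℚ
binaryPartialSum α (suc i) = binaryPartialSum α i + + toℕ (α i) / (2 ℕ.^ suc i)
  where instance _ = ℕ.m^n≢0 2 (suc i)

EventuallyOne : (ℕ → Bit) → Set
EventuallyOne α = ∃[ N ] (∀ i → N ℕ.≤ i → α i ≡ 1b)

record IsBinaryExpansion (α : ℕ → Bit) (x : ℚ) : Set where
  field
    converges      : ConvergesTo (binaryPartialSum α) x
    ¬eventuallyOne : ¬ EventuallyOne α

step : Bit → ℕ × ℕ → ℕ × ℕ
step (suc zero) (a , b) = a ℕ.+ 1 , b
step zero       (a , b) = a , b ℕ.+ 1

P : (ℕ → Bit) → ℕ → ℕ × ℕ
P α zero    = 0 , 0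
P α (suc i) = step (α i) (P α i)

X : (ℕ → Bit) → ℕ → ℕ
X α i = if does (uncurry gcd (P α i) ℕ.≟ 1) then 1 else 0

-- X₁ + ⋯ + Xₙ; the starting point P₀ is not counted.
ΣX : (ℕ → Bit) → ℕ → ℕ
ΣX α zero    = 0
ΣX α (suc n) = ΣX α n ℕ.+ X α (suc n)

S̄ : (ℕ → Bit) → (n : ℕ) .{{_ : NonZero n}} → ℚ
S̄ α n = + ΣX α n / n

{-# OPTIONS --safe #-}

-- Long division turns the expansion into the orbit of a remainder below the
-- denominator, so the digits are eventually periodic, say with period L. Over one
-- period P moves by a fixed vector (p , q), and D = | a q - b p | is constant along
-- the visits P = (a , b) to a fixed residue class mod L. As gcd (a , b) divides D, it
-- depends only on the visit number mod D when D ≠ 0; when D = 0 the point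
-- lies on the line spanned by (p , q) and is primitive at most finitely often. Since D
-- takes finitely many values, X is eventually periodic, hence its averages
-- converge to its mean over a period.

module Submission where

open import Defs
open import Data.Digit using (Bit; 1b)
open import Data.Nat.Base using (ℕ; suc)
open import Data.Product.Base using (∃-syntax)
open import Data.Rational.Base using (ℚ; 0ℚ; 1ℚ; _≤_; _<_)

open import Data.Bool.Base using (if_then_else_)
open import Data.Fin.Base using (Fin; toℕ; fromℕ<)
open import Data.Fin.Properties using (toℕ-injective; toℕ<n; pigeonhole; toℕ-fromℕ<)
open import Data.Integer.Base as ℤ using (+_; -[1+_])
import Data.Integer.Properties as ℤ
open import Data.Nat.Base as ℕ
  using (zero; _+_; _*_; _∸_; _^_; _!; _⊔_; ∣_-_∣; NonZero; s≤s; z≤n)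
open import Data.Nat.Coprimality as Coprimality using (gcd≡1⇒coprime; coprime-divisor)
open import Data.Nat.Divisibility
open import Data.Nat.DivMod
  using (_/_; _%_; +-distrib-/-∣ʳ; m<n⇒m/n≡0; m*n/n≡m; [m+kn]%n≡m%n; m<n⇒m%n≡m)
open import Data.Nat.GCD using (gcd; gcd[m,n]∣m; gcd[m,n]∣n; gcd-greatest)
open import Data.Nat.Induction using (<-rec)
open import Data.Nat.Properties as ℕ using (_!≢0)
open import Data.Nat.Tactic.RingSolver using (solve-∀)
open import Data.Product.Base using (_×_; _,_; proj₁; proj₂; uncurry)
open import Data.Rational.Base as ℚ using (mkℚ)
import Data.Rational.Properties as ℚ
open import Data.Rational.Unnormalised.Base as ℚᵘ using (mkℚᵘ; *≡*; *≤*; *<*)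
import Data.Rational.Unnormalised.Properties as ℚᵘ
open import Data.Sum.Base using (inj₁; inj₂)
open import Function.Base using (_∘_; _$_)
open import Relation.Binary.PropositionalEquality
open import Relation.Nullary using (yes; no; contradiction; does)

-- Eventually periodic sequences and their partial sums.

EventuallyPeriodic : {A : Set} → ℕ → ℕ → (ℕ → A) → Set
EventuallyPeriodic N L f = ∀ n → N ℕ.≤ n → f (n + L) ≡ f n

QuasiPeriodic : ℕ → ℕ → ℕ → (ℕ → ℕ) → Set
QuasiPeriodic N L p f = ∀ n → N ℕ.≤ n → f (n + L) ≡ f n + p

-- Strong induction: an index at or beyond `N + L` lies one period after an index that is still at
-- least `N`, and that is strictly smaller because `L` is nonzero.
periodic-induction : ∀ N L .{{_ : NonZero L}} (Q : ℕ → Set) →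
                     (∀ n → n ℕ.< N + L → Q n) →
                     (∀ n → N ℕ.≤ n → Q n → Q (n + L)) → ∀ n → Q n
periodic-induction N L Q base next = <-rec Q λ n rec → case n rec
  where
  case : ∀ n → (∀ {m} → m ℕ.< n → Q m) → Q n
  case n rec with n ℕ.<? N + L
  ... | yes n<N+L = base n n<N+L
  ... | no  n≮N+L = subst Q (ℕ.m∸n+n≡m L≤n) (next (n ∸ L) N≤n∸L (rec n∸L<n))
    where
    N+L≤n = ℕ.≮⇒≥ n≮N+L
    L≤n = ℕ.m+n≤o⇒n≤o N N+L≤n
    N≤n∸L = ℕ.m+n≤o⇒m≤o∸n N N+L≤n
    n∸L<n = ℕ.∸-monoʳ-< (ℕ.>-nonZero⁻¹ L) L≤n

-- Sliding a window of length `L` by one trades `g n` for `g (n + L)`; these are equal, so the gain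
-- of `f` over `L` steps stays what it is at `N`. As `f` is nondecreasing, the truncated subtraction
-- is exact.
sum-quasiPeriodic : ∀ {N L} {f g : ℕ → ℕ} → (∀ n → f (suc n) ≡ f n + g n) →
                    EventuallyPeriodic N L g → QuasiPeriodic N L (f (N + L) ∸ f N) f
sum-quasiPeriodic {N} {L} {f} {g} f-suc g-per n N≤n =
  subst (λ n → f (n + L) ≡ f n + p) (ℕ.m+[n∸m]≡n N≤n) (go (n ∸ N))
  where
  p = f (N + L) ∸ f N

  f-mono : ∀ k → f N ℕ.≤ f (N + k)
  f-mono zero    = ℕ.≤-reflexive (cong f (sym (ℕ.+-identityʳ N)))
  f-mono (suc k) rewrite ℕ.+-suc N k | f-suc (N + k) = ℕ.m≤n⇒m≤n+o (g (N + k)) (f-mono k)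

  go : ∀ k → f (N + k + L) ≡ f (N + k) + p
  go zero rewrite ℕ.+-identityʳ N = sym (ℕ.m+[n∸m]≡n (f-mono L))
  go (suc k) = begin
    f (N + suc k + L)                    ≡⟨ cong (λ m → f (m + L)) (ℕ.+-suc N k) ⟩
    f (suc (N + k + L))                  ≡⟨ f-suc (N + k + L) ⟩
    f (N + k + L) + g (N + k + L)        ≡⟨ cong₂ _+_ (go k) (g-per (N + k) (ℕ.m≤m+n N k)) ⟩
    f (N + k) + p + g (N + k)            ≡⟨ swap (f (N + k)) p (g (N + k)) ⟩
    f (N + k) + g (N + k) + p            ≡⟨ cong (_+ p) (f-suc (N + k)) ⟨
    f (suc (N + k)) + p                  ≡⟨ cong (λ m → f m + p) (ℕ.+-suc N k) ⟨
    f (N + suc k) + p                    ∎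
    where
    open ≡-Reasoning
    swap : ∀ a b c → a + b + c ≡ a + c + b
    swap = solve-∀

quasiPeriodic-* : ∀ {N L p f} → QuasiPeriodic N L p f → ∀ k → QuasiPeriodic N (k * L) (k * p) f
quasiPeriodic-* {f = f} _ zero n _ rewrite ℕ.+-identityʳ n = sym (ℕ.+-identityʳ (f n))
quasiPeriodic-* {L = L} {p} {f} qp (suc k) n N≤n = begin
  f (n + (L + k * L))   ≡⟨ cong f (ℕ.+-assoc n L (k * L)) ⟨
  f (n + L + k * L)     ≡⟨ quasiPeriodic-* qp k (n + L) (ℕ.m≤n⇒m≤n+o L N≤n) ⟩
  f (n + L) + k * p     ≡⟨ cong (_+ k * p) (qp n N≤n) ⟩
  f n + p + k * p       ≡⟨ ℕ.+-assoc (f n) p (k * p) ⟩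
  f n + (p + k * p)     ∎
  where open ≡-Reasoning

-- Determinants and gcds along a fixed direction.

-- The absolute value of the determinant of `(a , b)` and `(p , q)`.
defect : ℕ → ℕ → ℕ × ℕ → ℕ
defect p q (a , b) = ∣ a * q - b * p ∣

-- Both products grow by the same amount `k * p * q`, which cancels in the difference.
defect-shift : ∀ p q k a b → defect p q (a + k * p , b + k * q) ≡ defect p q (a , b)
defect-shift p q k a b = begin
  ∣ (a + k * p) * q - (b + k * q) * p ∣          ≡⟨ cong₂ ∣_-_∣ (eq₁ a k p q) (eq₂ b k p q) ⟩
  ∣ k * p * q + a * q - k * p * q + b * p ∣      ≡⟨ ℕ.∣m+n-m+o∣≡∣n-o∣ (k * p * q) _ _ ⟩
  ∣ a * q - b * p ∣                              ∎
  where
  open ≡-Reasoning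
  eq₁ : ∀ a k p q → (a + k * p) * q ≡ k * p * q + a * q
  eq₁ = solve-∀
  eq₂ : ∀ b k p q → (b + k * q) * p ≡ k * p * q + b * p
  eq₂ = solve-∀

-- From `N` on the defect repeats with period `L`, so indices below `N + L` decide, and there `f`
-- and `g` are below `N + L`. This serves twice: for the coordinates of the walk, and for the count
-- of primitive points paired with the index.
defect-bounded : ∀ {N L p q f g} .{{_ : NonZero L}} →
                 QuasiPeriodic N L p f → QuasiPeriodic N L q g →
                 (∀ n → f n ℕ.≤ n) → (∀ n → g n ℕ.≤ n) →
                 ∃[ K ] (∀ n → defect p q (f n , g n) ℕ.≤ K)
defect-bounded {N} {L} {p} {q} {f} {g} f-qp g-qp f≤ g≤ =
  K , periodic-induction N L _ base next
  where
  K = (N + L) * q ⊔ (N + L) * p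

  base : ∀ n → n ℕ.< N + L → defect p q (f n , g n) ℕ.≤ K
  base n n<N+L = ℕ.≤-trans (ℕ.∣m-n∣≤m⊔n (f n * q) (g n * p))
    (ℕ.⊔-mono-≤ (ℕ.*-monoˡ-≤ q (ℕ.≤-trans (f≤ n) (ℕ.<⇒≤ n<N+L)))
                (ℕ.*-monoˡ-≤ p (ℕ.≤-trans (g≤ n) (ℕ.<⇒≤ n<N+L))))

  next : ∀ n → N ℕ.≤ n → defect p q (f n , g n) ℕ.≤ K → defect p q (f (n + L) , g (n + L)) ℕ.≤ K
  next n N≤n d≤K = subst (ℕ._≤ K) (sym eq) d≤K
    where
    eq : defect p q (f (n + L) , g (n + L)) ≡ defect p q (f n , g n)
    eq = trans (cong (defect p q) (cong₂ _,_
                  (trans (f-qp n N≤n) (cong (λ r → f n + r) (sym (ℕ.*-identityˡ p))))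
                  (trans (g-qp n N≤n) (cong (λ r → g n + r) (sym (ℕ.*-identityˡ q))))))
               (defect-shift p q 1 (f n) (g n))

∣m∣n⇒∣∣m-n∣ : ∀ {d m n} → d ∣ m → d ∣ n → d ∣ ∣ m - n ∣
∣m∣n⇒∣∣m-n∣ {d} (divides-refl r) (divides-refl s) =
  divides ∣ r - s ∣ (sym (ℕ.*-distribʳ-∣-∣ d r s))

gcd∣defect : ∀ p q a b → gcd a b ∣ defect p q (a , b)
gcd∣defect p q a b =
  ∣m∣n⇒∣∣m-n∣ (∣m⇒∣m*n q (gcd[m,n]∣m a b)) (∣m⇒∣m*n p (gcd[m,n]∣n a b))

-- Each gcd divides the defect of its own point. The two defects agree, so both gcds divide `k`,
-- hence `k * p` and `k * q`, and each is a common divisor of the other pair.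
gcd-shift : ∀ p q k a b → defect p q (a , b) ∣ k → gcd (a + k * p) (b + k * q) ≡ gcd a b
gcd-shift p q k a b D∣k = ∣-antisym
  (gcd-greatest (∣m+n∣n⇒∣m (gcd[m,n]∣m a′ b′) (∣m⇒∣m*n p g′∣k))
                (∣m+n∣n⇒∣m (gcd[m,n]∣n a′ b′) (∣m⇒∣m*n q g′∣k)))
  (gcd-greatest (∣m∣n⇒∣m+n (gcd[m,n]∣m a b) (∣m⇒∣m*n p g∣k))
                (∣m∣n⇒∣m+n (gcd[m,n]∣n a b) (∣m⇒∣m*n q g∣k)))
  where
  a′ = a + k * p
  b′ = b + k * q
  g∣k : gcd a b ∣ k
  g∣k = ∣-trans (gcd∣defect p q a b) D∣k
  g′∣k : gcd a′ b′ ∣ k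
  g′∣k = ∣-trans (subst (gcd a′ b′ ∣_) (defect-shift p q k a b) (gcd∣defect p q a′ b′)) D∣k
  ∣m+n∣n⇒∣m : ∀ {d m n} → d ∣ m + n → d ∣ n → d ∣ m
  ∣m+n∣n⇒∣m {d} {m} {n} d∣m+n = ∣m+n∣m⇒∣n (subst (d ∣_) (ℕ.+-comm m n) d∣m+n)

-- A primitive vector parallel to (p , q) divides it, hence is not longer.
gcd≢1-parallel : ∀ p q a b → p + q ≢ 0 → defect p q (a , b) ≡ 0 → gcd (a + 2 * p) (b + 2 * q) ≢ 1
gcd≢1-parallel p q a b p+q≢0 D≡0 gcd≡1 = p+q≢0 (cong₂ _+_ (p≡0 p a a′∣p) (p≡0 q b b′∣q))
  where
  a′ = a + 2 * p
  b′ = b + 2 * q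
  a′q≡b′p : a′ * q ≡ b′ * p
  a′q≡b′p = ℕ.∣m-n∣≡0⇒m≡n (trans (defect-shift p q 2 a b) D≡0)
  cop = gcd≡1⇒coprime {a′} {b′} gcd≡1
  a′∣p : a′ ∣ p
  a′∣p = coprime-divisor cop (divides q (trans (sym a′q≡b′p) (ℕ.*-comm a′ q)))
  b′∣q : b′ ∣ q
  b′∣q = coprime-divisor (Coprimality.sym cop) (divides p (trans a′q≡b′p (ℕ.*-comm b′ p)))
  p≡0 : ∀ p a → a + 2 * p ∣ p → p ≡ 0
  p≡0 zero    _ _    = refl
  -- Two periods are added rather than one so that the sum exceeds `p` even when `a` is 0.
  p≡0 (suc r) a a+2p∣p = contradiction (∣⇒≤ a+2p∣p) (ℕ.<⇒≱
    (ℕ.<-≤-trans (ℕ.m<m+n (suc r) (s≤s z≤n)) (ℕ.m≤n+m (2 * suc r) a)))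

m≤n⇒m∣n! : ∀ {m n} .{{_ : NonZero m}} → m ℕ.≤ n → m ∣ n !
m≤n⇒m∣n! {suc m} m≤n = ∣-trans (m∣m*n (m !)) (m≤n⇒m!∣n! m≤n)

-- Periodicity of the primitivity indicator.

-- `X α i` unfolds to `isOne` of the gcd of the coordinates of `P α i`, so results about `isOne`
-- apply to `X` by definition.
isOne : ℕ → ℕ
isOne m = if does (m ℕ.≟ 1) then 1 else 0

isOne-≢ : ∀ {m} → m ≢ 1 → isOne m ≡ 0
isOne-≢ {0}           _   = refl
isOne-≢ {1}           1≢1 = contradiction refl 1≢1
isOne-≢ {suc (suc _)} _   = refl

isOne≤1 : ∀ m → isOne m ℕ.≤ 1
isOne≤1 0             = z≤n
isOne≤1 1             = ℕ.≤-refl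
isOne≤1 (suc (suc _)) = z≤n

-- A nonzero defect is at most K, so it divides K !, and shifting by K ! periods
-- preserves the gcd; where the defect is 0 the gcd is eventually never 1.
isOne-gcd-periodic : ∀ {N L p q a b} → p + q ≢ 0 →
                     QuasiPeriodic N L p a → QuasiPeriodic N L q b →
                     ∀ {K} → (∀ n → defect p q (a n , b n) ℕ.≤ K) →
                     EventuallyPeriodic (N + 2 * L) (K ! * L) (λ n → isOne (gcd (a n) (b n)))
isOne-gcd-periodic {N} {L} {p} {q} {a} {b} p+q≢0 a-qp b-qp {K} D≤K n N+2L≤n =
  -- The index is written as `2 * L` past one that is at least `N`, because `gcd≢1-parallel` speaks
  -- of points two periods further on.
  subst (λ n → χ (n + M) ≡ χ n) (ℕ.m∸n+n≡m 2L≤n) (periodic (n ∸ 2 * L) (ℕ.m+n≤o⇒m≤o∸n N N+2L≤n))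
  where
  M = K ! * L
  χ : ℕ → ℕ
  χ n = isOne (gcd (a n) (b n))
  2L≤n = ℕ.m+n≤o⇒n≤o N N+2L≤n

  a-shift : ∀ k → QuasiPeriodic N (k * L) (k * p) a
  a-shift = quasiPeriodic-* a-qp
  b-shift : ∀ k → QuasiPeriodic N (k * L) (k * q) b
  b-shift = quasiPeriodic-* b-qp

  gcd-cong : ∀ k n → N ℕ.≤ n → gcd (a (n + k * L)) (b (n + k * L)) ≡ gcd (a n + k * p) (b n + k * q)
  gcd-cong k n N≤n = cong₂ gcd (a-shift k n N≤n) (b-shift k n N≤n)

  D : ℕ → ℕ
  D n = defect p q (a n , b n)

  D-shift : ∀ k n → N ℕ.≤ n → D (n + k * L) ≡ D n
  D-shift k n N≤n = trans
    (cong (defect p q) (cong₂ _,_ (a-shift k n N≤n) (b-shift k n N≤n)))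
    (defect-shift p q k (a n) (b n))

  χ≡0 : ∀ n → N ℕ.≤ n → D n ≡ 0 → χ (n + 2 * L) ≡ 0
  χ≡0 n N≤n D≡0 = trans (cong isOne (gcd-cong 2 n N≤n))
                        (isOne-≢ (gcd≢1-parallel p q (a n) (b n) p+q≢0 D≡0))

  swap : ∀ x y z → x + y + z ≡ x + z + y
  swap = solve-∀

  periodic : ∀ n → N ℕ.≤ n → χ (n + 2 * L + M) ≡ χ (n + 2 * L)
  periodic n N≤n with D n ℕ.≟ 0
  ... | yes D≡0 = trans (cong χ (swap n (2 * L) M)) $ trans
    (χ≡0 (n + M) (ℕ.m≤n⇒m≤n+o M N≤n) (trans (D-shift (K !) n N≤n) D≡0))
    (sym (χ≡0 n N≤n D≡0))
  ... | no D≢0 = cong isOne $ trans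
    (gcd-cong (K !) m N≤m)
    (gcd-shift p q (K !) (a m) (b m) (m≤n⇒m∣n! {{D≢0′}} (D≤K m)))
    where
    m = n + 2 * L
    N≤m = ℕ.m≤n⇒m≤n+o (2 * L) N≤n
    D≢0′ = ℕ.≢-nonZero (D≢0 ∘ trans (sym (D-shift 2 n N≤n)))

-- The lattice walk and its counts.

P₁ P₂ : (ℕ → Bit) → ℕ → ℕ
P₁ α n = proj₁ (P α n)
P₂ α n = proj₂ (P α n)

P₁-suc : ∀ α n → P₁ α (suc n) ≡ P₁ α n + toℕ (α n)
P₁-suc α n with α n
... | Fin.zero       = sym (ℕ.+-identityʳ (P₁ α n))
... | Fin.suc Fin.zero = refl

P₂-suc : ∀ α n → P₂ α (suc n) ≡ P₂ α n + (1 ∸ toℕ (α n))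
P₂-suc α n with α n
... | Fin.zero       = refl
... | Fin.suc Fin.zero = sym (ℕ.+-identityʳ (P₂ α n))

P₁+P₂ : ∀ α n → P₁ α n + P₂ α n ≡ n
P₁+P₂ α zero = refl
P₁+P₂ α (suc n) with α n
... | Fin.zero       = trans (eq (P₁ α n) (P₂ α n)) (cong suc (P₁+P₂ α n))
  where
  eq : ∀ a b → a + (b + 1) ≡ suc (a + b)
  eq = solve-∀
... | Fin.suc Fin.zero = trans (eq (P₁ α n) (P₂ α n)) (cong suc (P₁+P₂ α n))
  where
  eq : ∀ a b → a + 1 + b ≡ suc (a + b)
  eq = solve-∀

ΣX≤n : ∀ α n → ΣX α n ℕ.≤ n
ΣX≤n α zero    = z≤n
ΣX≤n α (suc n) = ℕ.≤-trans (ℕ.+-mono-≤ (ΣX≤n α n) (isOne≤1 (uncurry gcd (P α (suc n)))))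
                           (ℕ.≤-reflexive (ℕ.+-comm n 1))

X-periodic : ∀ {N L α} .{{_ : NonZero L}} → EventuallyPeriodic N L α →
             ∃[ N′ ] ∃[ M ] NonZero M × EventuallyPeriodic N′ M (X α)
X-periodic {N} {L} {α} α-per =
  N + 2 * L , K ! * L , ℕ.m*n≢0 (K !) L {{K !≢0}} ,
  isOne-gcd-periodic {a = P₁ α} {P₂ α} p+q≢0 qp₁ qp₂ (proj₂ bounded)
  where
  p = P₁ α (N + L) ∸ P₁ α N
  q = P₂ α (N + L) ∸ P₂ α N
  qp₁ : QuasiPeriodic N L p (P₁ α)
  qp₁ = sum-quasiPeriodic (P₁-suc α) (λ n N≤n → cong toℕ (α-per n N≤n))
  qp₂ : QuasiPeriodic N L q (P₂ α)
  qp₂ = sum-quasiPeriodic (P₂-suc α) (λ n N≤n → cong (λ d → 1 ∸ toℕ d) (α-per n N≤n))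
  -- The coordinate sum grows by one per step, hence by `L` over a period; so the displacement
  -- `(p , q)` is not the zero vector.
  p+q≡L : p + q ≡ L
  p+q≡L = ℕ.+-cancelˡ-≡ N (p + q) L $ begin
    N + (p + q)                       ≡⟨ cong (_+ (p + q)) (P₁+P₂ α N) ⟨
    P₁ α N + P₂ α N + (p + q)         ≡⟨ eq (P₁ α N) (P₂ α N) p q ⟩
    (P₁ α N + p) + (P₂ α N + q)       ≡⟨ cong₂ _+_ (qp₁ N ℕ.≤-refl) (qp₂ N ℕ.≤-refl) ⟨
    P₁ α (N + L) + P₂ α (N + L)       ≡⟨ P₁+P₂ α (N + L) ⟩
    N + L                             ∎
    where
    open ≡-Reasoning
    eq : ∀ a b p q → a + b + (p + q) ≡ (a + p) + (b + q)
    eq = solve-∀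
  p+q≢0 : p + q ≢ 0
  p+q≢0 p+q≡0 = ℕ.≢-nonZero⁻¹ L (trans (sym p+q≡L) p+q≡0)
  bounded = defect-bounded {f = P₁ α} {P₂ α} qp₁ qp₂
    (λ n → ℕ.m+n≤o⇒m≤o (P₁ α n) (ℕ.≤-reflexive (P₁+P₂ α n)))
    (λ n → ℕ.m+n≤o⇒n≤o (P₁ α n) (ℕ.≤-reflexive (P₁+P₂ α n)))
  K = proj₁ bounded

-- The pair `(ΣX α n , n)` is itself quasi-periodic, with displacement `(c , M)`, where `c` is the
-- gain of `ΣX` over a period. Its bounded defect says that the averages stay within a multiple of
-- 1/n of c/M.
ΣX-defect-bounded : ∀ {N M α} .{{_ : NonZero M}} → EventuallyPeriodic N M (X α) →
                    ∃[ c ] ∃[ K ] (∀ n → ∣ ΣX α n * M - n * c ∣ ℕ.≤ K)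
ΣX-defect-bounded {N} {M} {α} X-per =
  _ , defect-bounded {N} {M} {f = ΣX α} {λ n → n}
        (sum-quasiPeriodic {f = ΣX α} {λ n → X α (suc n)} (λ _ → refl)
                           -- Passing from `n` to `suc n`, `ΣX` adds `X` at `suc n`, so periodicity
                           -- is used one index later.
                           (λ n N≤n → X-per (suc n) (ℕ.m≤n⇒m≤1+n N≤n)))
        (λ _ _ → refl) (ΣX≤n α) (λ _ → ℕ.≤-refl)

-- Comparing fractions by cross-multiplication.

-- Transfers statements on normalised quotients to unreduced fractions, where they are relations
-- between products.
toℚᵘ-/ : ∀ a b .{{_ : NonZero b}} → ℚ.toℚᵘ (a ℚ./ b) ℚᵘ.≃ a ℚᵘ./ b
toℚᵘ-/ a (suc b) = ℚ.toℚᵘ-fromℚᵘ (mkℚᵘ a b)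

/-mono-≤ : ∀ {a b c d} .{{_ : NonZero b}} .{{_ : NonZero d}} →
           a * d ℕ.≤ c * b → + a ℚ./ b ≤ + c ℚ./ d
/-mono-≤ {a} {b@(suc _)} {c} {d@(suc _)} ad≤cb = ℚ.toℚᵘ-cancel-≤ $
  ℚᵘ.≤-respˡ-≃ (ℚᵘ.≃-sym (toℚᵘ-/ (+ a) b)) $ ℚᵘ.≤-respʳ-≃ (ℚᵘ.≃-sym (toℚᵘ-/ (+ c) d)) $
  *≤* (subst₂ ℤ._≤_ (ℤ.pos-* a d) (ℤ.pos-* c b) (ℤ.+≤+ ad≤cb))

/-cancel-≤ : ∀ {a b c d} .{{_ : NonZero b}} .{{_ : NonZero d}} →
             + a ℚ./ b ≤ + c ℚ./ d → a * d ℕ.≤ c * b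
/-cancel-≤ {a} {b@(suc _)} {c} {d@(suc _)} p≤q
  with ℚᵘ.≤-respˡ-≃ (toℚᵘ-/ (+ a) b) (ℚᵘ.≤-respʳ-≃ (toℚᵘ-/ (+ c) d) (ℚ.toℚᵘ-mono-≤ p≤q))
... | *≤* ad≤cb =
  ℤ.drop‿+≤+ (subst₂ ℤ._≤_ (sym (ℤ.pos-* a d)) (sym (ℤ.pos-* c b)) ad≤cb)

/-+-/ : ∀ {a b c d e f} .{{_ : NonZero b}} .{{_ : NonZero d}} .{{_ : NonZero f}} →
        (a * d + c * b) * f ≡ e * (b * d) → + a ℚ./ b ℚ.+ + c ℚ./ d ≡ + e ℚ./ f
/-+-/ {a} {b@(suc _)} {c} {d@(suc _)} {e} {f@(suc _)} eq = ℚ.toℚᵘ-injective $ begin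
  ℚ.toℚᵘ (+ a ℚ./ b ℚ.+ + c ℚ./ d)               ≈⟨ ℚ.toℚᵘ-homo-+ (+ a ℚ./ b) (+ c ℚ./ d) ⟩
  ℚ.toℚᵘ (+ a ℚ./ b) ℚᵘ.+ ℚ.toℚᵘ (+ c ℚ./ d)     ≈⟨ ℚᵘ.+-cong (toℚᵘ-/ (+ a) b) (toℚᵘ-/ (+ c) d) ⟩
  + a ℚᵘ./ b ℚᵘ.+ + c ℚᵘ./ d                     ≈⟨ *≡* cross ⟩
  + e ℚᵘ./ f                                     ≈⟨ toℚᵘ-/ (+ e) f ⟨
  ℚ.toℚᵘ (+ e ℚ./ f)                             ∎
  where
  open ℚᵘ.≃-Reasoning
  num : + a ℤ.* + d ℤ.+ + c ℤ.* + b ≡ + (a * d + c * b)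
  num = trans (cong₂ ℤ._+_ (sym (ℤ.pos-* a d)) (sym (ℤ.pos-* c b))) (sym (ℤ.pos-+ (a * d) (c * b)))
  cross : (+ a ℤ.* + d ℤ.+ + c ℤ.* + b) ℤ.* + f ≡ + e ℤ.* + (b * d)
  cross = trans (cong (ℤ._* + f) num) $ trans (sym (ℤ.pos-* (a * d + c * b) f)) $
          trans (cong +_ eq) (ℤ.pos-* e (b * d))

∣m⊖n∣≡∣m-n∣ : ∀ m n → ℤ.∣ m ℤ.⊖ n ∣ ≡ ∣ m - n ∣
∣m⊖n∣≡∣m-n∣ m n with ℕ.≤-total m n
... | inj₁ m≤n = trans (ℤ.∣⊖∣-≤ m≤n) (sym (ℕ.m≤n⇒∣m-n∣≡n∸m m≤n))
... | inj₂ n≤m = trans (ℤ.∣m⊖n∣≡∣n⊖m∣ m n) $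
                 trans (ℤ.∣⊖∣-≤ n≤m) (sym (ℕ.m≤n⇒∣n-m∣≡n∸m n≤m))

-- The distance is the cross difference over `b * d`. The bound is in constructor form, since
-- matching on ε supplies its numerator and denominator.
∣/-/∣< : ∀ {a b c d} .{{_ : NonZero b}} .{{_ : NonZero d}} {e f} .{cop : Coprimality.Coprime e (suc f)} →
         ∣ a * d - c * b ∣ * suc f ℕ.< e * (b * d) →
         ℚ.∣ + a ℚ./ b ℚ.- + c ℚ./ d ∣ < mkℚ (+ e) f cop
∣/-/∣< {a} {b@(suc _)} {c} {d@(suc _)} {e} {f} lt = ℚ.toℚᵘ-cancel-< $
  ℚᵘ.<-respˡ-≃ (ℚᵘ.≃-sym dist≃) $ *<* $
  subst₂ ℤ._<_ (ℤ.pos-* ∣ a * d - c * b ∣ (suc f)) (ℤ.pos-* e (b * d)) (ℤ.+<+ lt)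
  where
  num : ℤ.∣ + a ℤ.* + d ℤ.+ ℤ.- (+ c) ℤ.* + b ∣ ≡ ∣ a * d - c * b ∣
  num = trans (cong ℤ.∣_∣ (trans
          (cong₂ ℤ._+_ (sym (ℤ.pos-* a d))
            (trans (sym (ℤ.neg-distribˡ-* (+ c) (+ b))) (cong ℤ.-_ (sym (ℤ.pos-* c b)))))
          (ℤ.m-n≡m⊖n (a * d) (c * b))))
        (∣m⊖n∣≡∣m-n∣ (a * d) (c * b))
  open ℚᵘ.≃-Reasoning
  dist≃ : ℚ.toℚᵘ ℚ.∣ + a ℚ./ b ℚ.- + c ℚ./ d ∣ ℚᵘ.≃ + ∣ a * d - c * b ∣ ℚᵘ./ (b * d)
  dist≃ = begin
    ℚ.toℚᵘ ℚ.∣ p ℚ.- q ∣                    ≈⟨ ℚ.toℚᵘ-homo-∣-∣ (p ℚ.- q) ⟩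
    ℚᵘ.∣ ℚ.toℚᵘ (p ℚ.- q) ∣                 ≈⟨ ℚᵘ.∣-∣-cong (ℚ.toℚᵘ-homo-+ p (ℚ.- q)) ⟩
    ℚᵘ.∣ ℚ.toℚᵘ p ℚᵘ.+ ℚ.toℚᵘ (ℚ.- q) ∣     ≈⟨ ℚᵘ.∣-∣-cong (ℚᵘ.+-cong (toℚᵘ-/ (+ a) b)
                                                (ℚᵘ.≃-trans (ℚ.toℚᵘ-homo‿- q) (ℚᵘ.-‿cong (toℚᵘ-/ (+ c) d)))) ⟩
    ℚᵘ.∣ + a ℚᵘ./ b ℚᵘ.- + c ℚᵘ./ d ∣       ≈⟨ *≡* (cong (λ n → + n ℤ.* + (b * d)) num) ⟩
    + ∣ a * d - c * b ∣ ℚᵘ./ (b * d)        ∎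
    where
    p = + a ℚ./ b
    q = + c ℚ./ d

-- Limits of rational sequences.

defect-bounded⇒converges : ∀ {f : ℕ → ℕ} {M c K} .{{_ : NonZero M}} →
                           (∀ n → ∣ f n * M - n * c ∣ ℕ.≤ K) →
                           ConvergesTo (λ n → + f (suc n) ℚ./ suc n) (+ c ℚ./ M)
defect-bounded⇒converges _ (mkℚ -[1+ _ ] _ _) (ℚ.*<* ())
defect-bounded⇒converges _ (mkℚ (+ zero) _ _) (ℚ.*<* (ℤ.+<+ ()))
defect-bounded⇒converges {f} {M} {c} {K} D≤K (mkℚ (+ suc e) d _) _ =
  -- With ε equal to `suc e` over `suc d`, the error at index `suc n` is at most K/((n+1)M), so `n`
  -- at least `K * suc d` suffices.
  K * suc d , λ n Kd≤n → ∣/-/∣< {f (suc n)} {suc n} {c} {M} $ begin-strict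
    ∣ f (suc n) * M - c * suc n ∣ * suc d   ≡⟨ cong (λ m → ∣ f (suc n) * M - m ∣ * suc d) (ℕ.*-comm c (suc n)) ⟩
    ∣ f (suc n) * M - suc n * c ∣ * suc d   ≤⟨ ℕ.*-monoˡ-≤ (suc d) (D≤K (suc n)) ⟩
    K * suc d                               ≤⟨ Kd≤n ⟩
    n                                       <⟨ ℕ.n<1+n n ⟩
    suc n                                   ≤⟨ ℕ.m≤m*n (suc n) M ⟩
    suc n * M                               ≤⟨ ℕ.m≤n*m (suc n * M) (suc e) ⟩
    suc e * (suc n * M)                     ∎
  where open ℕ.≤-Reasoning

-- If `l < c`, then `c - l` is an admissible ε, yet `s n - l` is at least that large for all `n`
-- from `N` on.
limit-≥ : ∀ {s l c} N → ConvergesTo s l → (∀ n → N ℕ.≤ n → c ≤ s n) → c ≤ l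
limit-≥ {s} {l} {c} N s→l c≤s = ℚ.≮⇒≥ λ l<c →
  let 0<c-l : 0ℚ < c ℚ.- l
      0<c-l = subst (_< c ℚ.- l) (ℚ.+-inverseʳ l) (ℚ.+-monoˡ-< (ℚ.- l) l<c)
      N′ , close = s→l (c ℚ.- l) 0<c-l
      n = N ⊔ N′
      c-l≤s-l : c ℚ.- l ≤ s n ℚ.- l
      c-l≤s-l = ℚ.+-monoˡ-≤ (ℚ.- l) (c≤s n (ℕ.m≤m⊔n N N′))
      ∣s-l∣≡ = ℚ.0≤p⇒∣p∣≡p (ℚ.≤-trans (ℚ.<⇒≤ 0<c-l) c-l≤s-l)
  in ℚ.<-irrefl refl
       (ℚ.<-≤-trans (subst (_< c ℚ.- l) ∣s-l∣≡ (close n (ℕ.m≤n⊔m N N′))) c-l≤s-l)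

limit-≤ : ∀ {s l c} N → ConvergesTo s l → (∀ n → N ℕ.≤ n → s n ≤ c) → l ≤ c
limit-≤ {s} {l} {c} N s→l s≤c = ℚ.≮⇒≥ λ c<l → ℚ.<-irrefl refl $
  ℚ.≤-<-trans (limit-≥ N -s→-l (λ n N≤n → ℚ.neg-antimono-≤ (s≤c n N≤n))) (ℚ.neg-antimono-< c<l)
  where
  -s→-l : ConvergesTo (λ n → ℚ.- s n) (ℚ.- l)
  -s→-l ε 0<ε with s→l ε 0<ε
  ... | N , close = N , λ n N≤n → subst (_< ε) (∣s-l∣≡ n) (close n N≤n)
    where
    ∣s-l∣≡ : ∀ n → ℚ.∣ s n ℚ.- l ∣ ≡ ℚ.∣ ℚ.- s n ℚ.- ℚ.- l ∣
    ∣s-l∣≡ n = trans (sym (ℚ.∣-p∣≡∣p∣ (s n ℚ.- l))) (cong ℚ.∣_∣ (ℚ.neg-distrib-+ (s n) (ℚ.- l)))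

-- Truncated binary expansions.

-- For an expansion of x without a tail of ones, this turns out to be the integer part of x times
-- `2 ^ i`.
prefix : (ℕ → Bit) → ℕ → ℕ
prefix α zero    = 0
prefix α (suc i) = 2 * prefix α i + toℕ (α i)

dyadic : ℕ → ℕ → ℚ
dyadic a i = (+ a ℚ./ (2 ^ i)) {{ℕ.m^n≢0 2 i}}

binaryPartialSum≡ : ∀ α i → binaryPartialSum α i ≡ dyadic (prefix α i) i
binaryPartialSum≡ α zero    = refl
binaryPartialSum≡ α (suc i) =
  trans (cong (ℚ._+ dyadic (toℕ (α i)) (suc i)) (binaryPartialSum≡ α i))
        (/-+-/ {a} {2 ^ i} {c} {2 ^ suc i} {2 * a + c} {2 ^ suc i} (eq a c (2 ^ i)))
  where
  a = prefix α i
  c = toℕ (α i)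
  instance
    _ = ℕ.m^n≢0 2 i
    _ = ℕ.m^n≢0 2 (suc i)
  eq : ∀ a c t → (a * (2 * t) + c * t) * (2 * t) ≡ (2 * a + c) * (t * (2 * t))
  eq = solve-∀

prefix-lower : ∀ α i k → prefix α i * 2 ^ k ℕ.≤ prefix α (i + k)
prefix-lower α i zero rewrite ℕ.+-identityʳ i = ℕ.≤-reflexive (ℕ.*-identityʳ (prefix α i))
prefix-lower α i (suc k) rewrite ℕ.+-suc i k = begin
  prefix α i * (2 * 2 ^ k)                        ≡⟨ eq (prefix α i) (2 ^ k) ⟩
  2 * (prefix α i * 2 ^ k)                        ≤⟨ ℕ.*-monoʳ-≤ 2 (prefix-lower α i k) ⟩
  2 * prefix α (i + k)                            ≤⟨ ℕ.m≤m+n _ _ ⟩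
  2 * prefix α (i + k) + toℕ (α (i + k))          ∎
  where
  open ℕ.≤-Reasoning
  eq : ∀ a t → a * (2 * t) ≡ 2 * (a * t)
  eq = solve-∀

suc-prefix-suc : ∀ α i → suc (prefix α (suc i)) ℕ.≤ 2 * suc (prefix α i)
suc-prefix-suc α i = begin
  suc (2 * prefix α i + toℕ (α i))      ≡⟨ ℕ.+-suc _ _ ⟨
  2 * prefix α i + suc (toℕ (α i))      ≤⟨ ℕ.+-monoʳ-≤ (2 * prefix α i) (toℕ<n (α i)) ⟩
  2 * prefix α i + 2                    ≡⟨ eq (prefix α i) ⟩
  2 * suc (prefix α i)                  ∎
  where
  open ℕ.≤-Reasoning
  eq : ∀ a → 2 * a + 2 ≡ 2 * suc a
  eq = solve-∀

-- A block of `k` further digits contributes at most `2 ^ k` minus 1; the successors on both sides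
-- express this without subtraction and let the induction close.
prefix-upper : ∀ α i k → suc (prefix α (i + k)) ℕ.≤ suc (prefix α i) * 2 ^ k
prefix-upper α i zero rewrite ℕ.+-identityʳ i = ℕ.≤-reflexive (sym (ℕ.*-identityʳ (suc (prefix α i))))
prefix-upper α i (suc k) rewrite ℕ.+-suc i k = begin
  suc (prefix α (suc (i + k)))                ≤⟨ suc-prefix-suc α (i + k) ⟩
  2 * suc (prefix α (i + k))                  ≤⟨ ℕ.*-monoʳ-≤ 2 (prefix-upper α i k) ⟩
  2 * (suc (prefix α i) * 2 ^ k)              ≡⟨ eq (suc (prefix α i)) (2 ^ k) ⟩
  suc (prefix α i) * (2 * 2 ^ k)              ∎
  where
  open ℕ.≤-Reasoning
  eq : ∀ a t → 2 * (a * t) ≡ a * (2 * t)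
  eq = solve-∀

dyadic-mono : ∀ a i b j → a * 2 ^ j ℕ.≤ b * 2 ^ i → dyadic a i ≤ dyadic b j
dyadic-mono a i b j = /-mono-≤ {a} {2 ^ i} {b} {2 ^ j} {{ℕ.m^n≢0 2 i}} {{ℕ.m^n≢0 2 j}}

*-2^-mono : ∀ a {b} i k → a * 2 ^ k ℕ.≤ b → a * 2 ^ (i + k) ℕ.≤ b * 2 ^ i
*-2^-mono a {b} i k a2ᵏ≤b = begin
  a * 2 ^ (i + k)        ≡⟨ cong (a *_) (ℕ.^-distribˡ-+-* 2 i k) ⟩
  a * (2 ^ i * 2 ^ k)    ≡⟨ eq a (2 ^ i) (2 ^ k) ⟩
  a * 2 ^ k * 2 ^ i      ≤⟨ ℕ.*-monoˡ-≤ (2 ^ i) a2ᵏ≤b ⟩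
  b * 2 ^ i              ∎
  where
  open ℕ.≤-Reasoning
  eq : ∀ a s t → a * (s * t) ≡ a * t * s
  eq = solve-∀

*-2^-mono′ : ∀ a {b} i k → b ℕ.≤ a * 2 ^ k → b * 2 ^ i ℕ.≤ a * 2 ^ (i + k)
*-2^-mono′ a {b} i k b≤a2ᵏ = begin
  b * 2 ^ i              ≤⟨ ℕ.*-monoˡ-≤ (2 ^ i) b≤a2ᵏ ⟩
  a * 2 ^ k * 2 ^ i      ≡⟨ eq a (2 ^ i) (2 ^ k) ⟩
  a * (2 ^ i * 2 ^ k)    ≡⟨ cong (a *_) (ℕ.^-distribˡ-+-* 2 i k) ⟨
  a * 2 ^ (i + k)        ∎
  where
  open ℕ.≤-Reasoning
  eq : ∀ a s t → a * t * s ≡ a * (s * t)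
  eq = solve-∀

-- A digit 0 would make the right side `2 * a + 1`, one too small.
last-digit≡1b : ∀ {a} (b : Bit) → 2 * suc a ℕ.≤ suc (2 * a + toℕ b) → b ≡ 1b
last-digit≡1b     (Fin.suc Fin.zero) _  = refl
last-digit≡1b {a} Fin.zero           le = contradiction le (ℕ.<⇒≱ (ℕ.≤-reflexive (eq a)))
  where
  eq : ∀ a → suc (suc (2 * a + 0)) ≡ 2 * suc a
  eq = solve-∀

-- Long division and periodicity of the digits.

module _ (α : ℕ → Bit) (n d : ℕ) .{{d≢0 : NonZero d}} (expansion : IsBinaryExpansion α (+ n ℚ./ d)) where
  open IsBinaryExpansion expansion

  -- Later digits only add, so every partial sum from `i` on is at least the truncation at `i`, and
  -- so is the limit.
  limit-lower : ∀ i → prefix α i * d ℕ.≤ n * 2 ^ i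
  limit-lower i = /-cancel-≤ {prefix α i} {2 ^ i} {n} {d} {{ℕ.m^n≢0 2 i}} $
    limit-≥ {c = dyadic (prefix α i) i} i converges λ j i≤j →
      subst (λ j → dyadic (prefix α i) i ≤ binaryPartialSum α j)
      (ℕ.m+[n∸m]≡n i≤j) (below (j ∸ i))
    where
    below : ∀ k → dyadic (prefix α i) i ≤ binaryPartialSum α (i + k)
    below k = subst (dyadic (prefix α i) i ≤_) (sym (binaryPartialSum≡ α (i + k)))
      (dyadic-mono (prefix α i) i (prefix α (i + k)) (i + k)
        (*-2^-mono (prefix α i) i k (prefix-lower α i k)))

  -- All digits after the first `i` together add less than one unit of the last place to any partial
  -- sum; the limit keeps only the weak inequality.
  limit-upper : ∀ i → n * 2 ^ i ℕ.≤ suc (prefix α i) * d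
  limit-upper i = /-cancel-≤ {n} {d} {suc (prefix α i)} {2 ^ i} {{d≢0}} {{ℕ.m^n≢0 2 i}} $
    limit-≤ {c = dyadic (suc (prefix α i)) i} i converges λ j i≤j →
      subst (λ j → binaryPartialSum α j ≤ dyadic (suc (prefix α i)) i)
      (ℕ.m+[n∸m]≡n i≤j) (above (j ∸ i))
    where
    above : ∀ k → binaryPartialSum α (i + k) ≤ dyadic (suc (prefix α i)) i
    above k = subst (_≤ dyadic (suc (prefix α i)) i) (sym (binaryPartialSum≡ α (i + k)))
      (dyadic-mono (prefix α (i + k)) (i + k) (suc (prefix α i)) i
        (*-2^-mono′ (suc (prefix α i)) i k (ℕ.≤-trans (ℕ.n≤1+n (prefix α (i + k))) (prefix-upper α i k))))

  -- Equality in limit-upper propagates to all later digits and forces each of them to be 1.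
  limit-upper-strict : ∀ i → n * 2 ^ i ℕ.< suc (prefix α i) * d
  limit-upper-strict i = ℕ.≤∧≢⇒< (limit-upper i) λ eq → ¬eventuallyOne
    (i , λ j i≤j → subst (λ j → α j ≡ 1b) (ℕ.m+[n∸m]≡n i≤j)
      (last-digit≡1b (α (i + (j ∸ i))) (tight-suc≤ (i + (j ∸ i)) (tight eq (j ∸ i)))))
    where
    Tight : ℕ → Set
    Tight j = n * 2 ^ j ≡ suc (prefix α j) * d

    double : ∀ j → Tight j → n * 2 ^ suc j ≡ 2 * suc (prefix α j) * d
    double j t = trans (eq₁ n (2 ^ j)) (trans (cong (2 *_) t) (sym (ℕ.*-assoc 2 (suc (prefix α j)) d)))
      where
      eq₁ : ∀ n t → n * (2 * t) ≡ 2 * (n * t)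
      eq₁ = solve-∀

    tight-suc≤ : ∀ j → Tight j → 2 * suc (prefix α j) ℕ.≤ suc (prefix α (suc j))
    tight-suc≤ j t = ℕ.*-cancelʳ-≤ _ _ d
      (ℕ.≤-trans (ℕ.≤-reflexive (sym (double j t))) (limit-upper (suc j)))

    tight-suc : ∀ j → Tight j → Tight (suc j)
    tight-suc j t = trans (double j t)
      (cong (_* d) (ℕ.≤-antisym (tight-suc≤ j t) (suc-prefix-suc α j)))

    tight : Tight i → ∀ k → Tight (i + k)
    tight t zero    = subst Tight (sym (ℕ.+-identityʳ i)) t
    tight t (suc k) = subst Tight (sym (ℕ.+-suc i k)) (tight-suc (i + k) (tight t k))

  -- The state of the long division of `n` by `d` in base 2: `d` times the fractional part of
  -- `n * 2 ^ i` over `d`.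
  remainder : ℕ → ℕ
  remainder i = n * 2 ^ i ∸ prefix α i * d

  remainder+prefix : ∀ i → remainder i + prefix α i * d ≡ n * 2 ^ i
  remainder+prefix i = ℕ.m∸n+n≡m (limit-lower i)

  remainder<d : ∀ i → remainder i ℕ.< d
  remainder<d i = ℕ.+-cancelʳ-< (prefix α i * d) (remainder i) d
    (subst (ℕ._< suc (prefix α i) * d) (sym (remainder+prefix i)) (limit-upper-strict i))

  long-division : ∀ i → 2 * remainder i ≡ remainder (suc i) + toℕ (α i) * d
  long-division i = ℕ.+-cancelʳ-≡ (2 * a * d) _ _ $ begin
    2 * remainder i + 2 * a * d                   ≡⟨ eq₁ (remainder i) a d ⟩
    2 * (remainder i + a * d)                     ≡⟨ cong (2 *_) (remainder+prefix i) ⟩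
    2 * (n * 2 ^ i)                               ≡⟨ eq₂ n (2 ^ i) ⟩
    n * 2 ^ suc i                                 ≡⟨ remainder+prefix (suc i) ⟨
    remainder (suc i) + (2 * a + toℕ (α i)) * d   ≡⟨ eq₃ (remainder (suc i)) a (toℕ (α i)) d ⟩
    remainder (suc i) + toℕ (α i) * d + 2 * a * d ∎
    where
    open ≡-Reasoning
    a = prefix α i
    eq₁ : ∀ r a d → 2 * r + 2 * a * d ≡ 2 * (r + a * d)
    eq₁ = solve-∀
    eq₂ : ∀ n t → 2 * (n * t) ≡ n * (2 * t)
    eq₂ = solve-∀
    eq₃ : ∀ r a c d → r + (2 * a + c) * d ≡ r + c * d + 2 * a * d
    eq₃ = solve-∀

  -- Since the new remainder is below `d`, `long-division` is Euclidean division of the doubled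
  -- remainder, with the digit as quotient. The remainders thus follow a recursion that does not
  -- mention `α`.
  remainder-suc : ∀ i → remainder (suc i) ≡ (2 * remainder i) % d
  remainder-suc i = sym $ trans (cong (_% d) (long-division i)) $
    trans ([m+kn]%n≡m%n (remainder (suc i)) (toℕ (α i)) d) (m<n⇒m%n≡m (remainder<d (suc i)))

  digit≡ : ∀ i → toℕ (α i) ≡ (2 * remainder i) / d
  digit≡ i = sym $ trans (cong (_/ d) (long-division i)) $
    trans (+-distrib-/-∣ʳ (remainder (suc i)) (n∣m*n (toℕ (α i)))) $
    cong₂ _+_ (m<n⇒m/n≡0 (remainder<d (suc i))) (m*n/n≡m (toℕ (α i)) d)

-- Among the first `d + 1` values, all below `d`, two coincide; as each value determines the next,
-- the coincidence persists, and the gap is a period.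
orbit-periodic : ∀ {d} {r : ℕ → ℕ} {φ : ℕ → ℕ} → (∀ i → r i ℕ.< d) → (∀ i → r (suc i) ≡ φ (r i)) →
                 ∃[ N ] ∃[ L ] NonZero L × EventuallyPeriodic N L r
orbit-periodic {d} {r} {φ} r<d r-suc
  with pigeonhole (ℕ.n<1+n d) (λ i → fromℕ< (r<d (toℕ i)))
... | i , j , i<j , eq =
  toℕ i , toℕ j ∸ toℕ i , ℕ.>-nonZero (ℕ.m<n⇒0<n∸m i<j) , λ n i≤n →
  subst (λ n → r (n + (toℕ j ∸ toℕ i)) ≡ r n) (ℕ.m+[n∸m]≡n i≤n) (go (n ∸ toℕ i))
  where
  ri≡rj : r (toℕ i) ≡ r (toℕ j)
  ri≡rj = trans (sym (toℕ-fromℕ< (r<d (toℕ i)))) (trans (cong toℕ eq) (toℕ-fromℕ< (r<d (toℕ j))))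

  go : ∀ k → r (toℕ i + k + (toℕ j ∸ toℕ i)) ≡ r (toℕ i + k)
  go zero rewrite ℕ.+-identityʳ (toℕ i) =
    trans (cong r (ℕ.m+[n∸m]≡n (ℕ.<⇒≤ i<j))) (sym ri≡rj)
  go (suc k) rewrite ℕ.+-suc (toℕ i) k =
    trans (r-suc _) (trans (cong φ (go k)) (sym (r-suc _)))

digits-periodic : ∀ α n d .{{_ : NonZero d}} → IsBinaryExpansion α (+ n ℚ./ d) →
                  ∃[ N ] ∃[ L ] NonZero L × EventuallyPeriodic N L α
digits-periodic α n d e =
  let N , L , L≢0 , r-per = orbit-periodic {φ = λ r → (2 * r) % d} (remainder<d α n d e) (remainder-suc α n d e)
      digit = digit≡ α n d e
  in N , L , L≢0 , λ i N≤i → toℕ-injective $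
     trans (digit (i + L)) (trans (cong (λ r → (2 * r) / d) (r-per i N≤i)) (sym (digit i)))

-- From periodic digits to the limit of the averages.

periodic⇒average-converges : ∀ {N L} α .{{_ : NonZero L}} → EventuallyPeriodic N L α →
                             ∃[ q ] ConvergesTo (λ n → S̄ α (suc n)) q
periodic⇒average-converges {N} {L} α α-per =
  let N′ , M , M≢0 , X-per = X-periodic {N} {L} {α} α-per
      c , K , D≤K = ΣX-defect-bounded {N′} {M} {α} {{M≢0}} X-per
  in (+ c ℚ./ M) {{M≢0}} , defect-bounded⇒converges {ΣX α} {M} {c} {{M≢0}} D≤K

theorem3 : ∀ (x : ℚ) → 0ℚ ≤ x → x < 1ℚ →
    ∀ (α : ℕ → Bit) → IsBinaryExpansion α x →
    ∃[ q ] ConvergesTo (λ n → S̄ α (suc n)) q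
theorem3 (mkℚ -[1+ _ ] _ _) (ℚ.*≤* ()) _ _ _
theorem3 x@(mkℚ (+ n) d-1 _) _ _ α e =
  let e′ = subst (IsBinaryExpansion α) (sym (ℚ.↥p/↧p≡p x)) e
      N , L , L≢0 , α-per = digits-periodic α n (suc d-1) e′
  in periodic⇒average-converges {N} α {{L≢0}} α-per
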